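{- The problem of deciding, given a HyperLTL formula $\varphi = Q_1\pi_1\ldots Q_n\pi_n\mathpunct{.}\phi$ that is temporal safety, whether there exists a non-empty set of traces $T\subseteq\Sigma^\omega$ with $T\models\varphi$, is in $\texttt{coRE}$.
   Context: Fix a finite set $\mathit{AP}$ of atomic propositions and let $\Sigma=2^{\mathit{AP}}$; traces are elements of $\Sigma^\omega$. LTL: $\psi ::= a \mid \neg\psi \mid \psi\wedge\psi \mid \mathsf{X}\psi \mid \psi\,\mathsf{U}\,\psi$ with standard semantics. HyperLTL: $\varphi ::= \exists\pi\mathpunct{.}\varphi \mid \forall\pi\mathpunct{.}\varphi \mid \phi$, $\phi ::= a_\pi \mid \neg\phi\mid\phi\wedge\phi\mid\mathsf{X}\phi\mid\phi\,\mathsf{U}\,\phi$ (closed formulas only). Semantics w.r.t. a set of traces $T$ and trace assignment $\Pi$: $\Pi\models_T a_\pi$ iff $a\in\Pi(\pi)(0)$; Boolean connectives as usual; $\mathsf{X}$ and $\mathsf{U}$ shift all traces in $\Pi$ synchronously as in LTL; $\exists\pi$ / $\forall\pi$ range over $t\in T$. $T\models\varphi$ iff $\varphi$ holds under the empty assignment. A trace property $P\subseteq\Sigma^\omega$ is safety if for every $t\notin P$ there is a finite prefix $u$ of $t$ such that no trace extending $u$ is in $P$. A HyperLTL formula $Q_1\pi_1\ldots Q_n\pi_n\mathpunct{.}\phi$ is temporal safety if $\phi$, read as an LTL formula over $\mathit{AP}_{\pi_1}\cup\cdots\cup\mathit{AP}_{\pi_n}$ (with $\mathit{AP}_\pi=\{a_\pi\mid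 a\in\mathit{AP}\}$), describes a safety property. -}

module Defs where

open import Level using (0ℓ)
open import Data.Nat using (ℕ; zero; suc; _+_; _<_)
open import Data.Fin using (Fin)
import Data.Fin as F
open import Data.Fin.Subset using (Subset; _∈_)
open import Data.Vec using (Vec; []; _∷_; tabulate; lookup)
open import Data.Product using (Σ; _×_; ∃)
open import Relation.Nullary using (¬_)
open import Relation.Unary using (Pred)
open import Relation.Binary.PropositionalEquality using (_≡_)

-- AP = Fin k (k atomic propositions); a letter of Σ = 2^AP is a Subset k.
Letter : ℕ → Set
Letter k = Subset k

Trace : ℕ → Set
Trace k = ℕ → Letter k

data Body (k n : ℕ) : Set where
  atom : Fin k → Fin n → Body k n
  neg  : Body k n → Body k n
  and  : Body k n → Body k n → Body k n
  next : Body k n → Body k n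
  until : Body k n → Body k n → Body k n

data Quant : Set where
  ∃q ∀q : Quant

-- Q₁π₁ … Qₙπₙ. φ ; variable i : Fin n is bound by the (i+1)-th quantifier
record Formula (k : ℕ) : Set where
  constructor hyper
  field
    n      : ℕ
    prefix : Vec Quant n
    body   : Body k n

-- a letter of the extended alphabet 2^(AP_π₁ ∪ … ∪ AP_πₙ), as an n-tuple of subsets of AP
ExtLetter : ℕ → ℕ → Set
ExtLetter k n = Vec (Subset k) n

ExtWord : ℕ → ℕ → Set
ExtWord k n = ℕ → ExtLetter k n

lookupL : ∀ {k n} → ExtLetter k n → Fin n → Subset k
lookupL = lookup


_,_⊨_ : ∀ {k n} → ExtWord k n → ℕ → Body k n → Set
w , i ⊨ atom a x  = a ∈ lookupL (w i) x
w , i ⊨ neg φ     = ¬ (w , i ⊨ φ)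
w , i ⊨ and φ ψ   = (w , i ⊨ φ) × (w , i ⊨ ψ)
w , i ⊨ next φ    = w , suc i ⊨ φ
w , i ⊨ until φ ψ = Σ ℕ λ m → (w , i + m ⊨ ψ) × (∀ j → j < m → w , i + j ⊨ φ)

LTLProp : ∀ {k n} → Body k n → Pred (ExtWord k n) 0ℓ
LTLProp φ w = w , 0 ⊨ φ

Safety : {A : Set} → Pred (ℕ → A) 0ℓ → Set
Safety {A} P = ∀ (t : ℕ → A) → ¬ P t →
  Σ ℕ λ m → ∀ (t' : ℕ → A) → (∀ i → i < m → t' i ≡ t i) → ¬ P t'

TemporalSafety : ∀ {k} → Formula k → Set
TemporalSafety φ = Safety (LTLProp (Formula.body φ))

zipAssign : ∀ {k n} → (Fin n → Trace k) → ExtWord k n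
zipAssign Π i = tabulate (λ x → Π x i)

cons : ∀ {k n} → Trace k → (Fin n → Trace k) → Fin (suc n) → Trace k
cons t Π F.zero    = t
cons t Π (F.suc x) = Π x

-- Q₁π₁ … Qₘπₘ. P, quantifiers ranging over T; the first quantifier binds variable zero
QSat : ∀ {k m} → Pred (Trace k) 0ℓ → Vec Quant m → ((Fin m → Trace k) → Set) → Set
QSat T []             P = P (λ ())
QSat T (∃q ∷ qs) P = Σ (Trace _) λ t → T t × QSat T qs (λ Π → P (cons t Π))
QSat T (∀q ∷ qs) P = (t : Trace _) → T t → QSat T qs (λ Π → P (cons t Π))

_⊨ᴴ_ : ∀ {k} → Pred (Trace k) 0ℓ → Formula k → Set
T ⊨ᴴ hyper n qs φ = QSat T qs (λ Π → zipAssign Π , 0 ⊨ φ)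

Satisfiable : ∀ {k} → Formula k → Set₁
Satisfiable {k} φ = Σ (Pred (Trace k) 0ℓ) λ T → (∃ λ t → T t) × (T ⊨ᴴ φ)

-- Call a set U of length-m prefixes of traces a prefix model of φ = Q₁π₁ … Qₙπₙ. β if U is nonempty
-- and the quantifier prefix holds with the quantifiers ranging over U and β read as "the combined
-- prefix extends to an infinite word satisfying β". The length-m prefixes of a model of φ form a
-- prefix model. Conversely, suppose there are prefix models of every length. There are finitely many
-- candidates of each length and truncation maps prefix models to prefix models, so König's lemma gives
-- a coherent sequence of them, and the traces all of whose prefixes lie in it form a model of φ:
-- existential witnesses are again branches given by König's lemma, and β holds in the limit because
-- it describes a safety property. Extendability of a prefix is decidable on the tableau of β, a
-- generalised Büchi automaton: the prefix must label a path into a node from which a fair lasso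
-- starts. Hence the existence of a prefix model of length m is decidable, and φ is unsatisfiable iff
-- some length has none, which is what the procedure searches for.

module Submission where

open import Defs
import Level
open import Level using (0ℓ; lift; lower)
open import Axiom.ExcludedMiddle using (ExcludedMiddle)
open import Data.Bool using (Bool; true; false; not; _∨_; T)
open import Data.Bool.Properties using (T-≡)
open import Data.Empty using (⊥-elim)
open import Data.Fin using (Fin; toℕ; _≟_) renaming (zero to fzero; suc to fsuc)
open import Data.Fin.Properties using (pigeonhole; toℕ<n)
open import Data.Fin.Subset using () renaming (_∈_ to _∈ˢ_)
open import Data.Fin.Subset.Properties using () renaming (_∈?_ to _∈ˢ?_)
open import Data.List as List using (List; []; _∷_; _++_; map; foldr; cartesianProduct)
open import Data.List.Membership.Propositional using (_∈_; lose)
open import Data.List.Membership.Propositional.Properties using (∈-cartesianProduct⁺; ∈-map⁺)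
open import Data.List.Relation.Unary.All as All using (All; []; _∷_)
import Data.List.Relation.Unary.All.Properties as All
import Data.List.Relation.Unary.Any as Any
import Data.List.Relation.Unary.Any.Properties as Any
open import Data.List.Relation.Unary.Any using (here; there)
open import Data.Nat
  using (ℕ; zero; suc; _+_; _*_; _∸_; _⊔_; _≤_; _<_; _≤?_; _≤′_; ≤′-refl; ≤′-step; z≤n; s≤s; s≤s⁻¹; z<s;
         NonZero; >-nonZero)
open import Data.Nat.DivMod using (_%_; _/_; m≡m%n+[m/n]*n; [m+kn]%n≡m%n; m<n⇒m%n≡m; n%n≡0; m%n<n)
open import Data.Nat.Properties
  using (≤-refl; ≤-trans; m≤m+n; m≤m⊔n; m≤n⊔m; m≤n+m; ≤⇒≤′; m<1+n⇒m<n∨m≡n; +-suc; +-identityʳ;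
         m+[n∸m]≡n; m+n∸m≡n; m≤n⇒m<n∨m≡n; <-irrefl; <-≤-trans; +-cancelˡ-≡; +-cancelˡ-<; <⇒≤; ≰⇒>;
         m≤n⇒∃[o]m+o≡n; +-monoʳ-<; +-monoˡ-<; m≤m*n; n<1+n)
open import Data.Product using (Σ; ∃; ∃₂; _×_; _,_; proj₁; proj₂; uncurry)
open import Data.Sum using (_⊎_; inj₁; inj₂)
open import Data.Unit using (⊤; tt)
open import Data.Vec as Vec using (Vec; []; _∷_)
open import Data.Vec.Properties using (lookup∘tabulate; tabulate-cong)
open import Function using (_∘_)
open import Function.Bundles using (_⇔_; mk⇔; Equivalence)
open import Function.Properties.Equivalence using () renaming (refl to ⇔-refl; sym to ⇔-sym; trans to ⇔-trans)
open import Function.Related.TypeIsomorphisms using (¬-cong-⇔)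
open import Data.Product.Function.NonDependent.Propositional using (_×-⇔_)
open import Data.Sum.Function.Propositional using (_⊎-⇔_)
open import Relation.Nullary using (¬_; Dec; yes; no; does)
open import Relation.Nullary.Decidable using (map′; decidable-stable; _×-dec_; _⊎-dec_; _→-dec_; ¬?; T?)
open import Relation.Binary using (DecidableEquality)
open import Relation.Unary using (Decidable)
open import Relation.Binary.PropositionalEquality using (_≡_; refl; sym; trans; cong; cong₂; subst; subst₂)

T-does : {P : Set} (P? : Dec P) → T (does P?) ⇔ P
T-does (yes p) = mk⇔ (λ _ → p) (λ _ → tt)
T-does (no ¬p) = mk⇔ (λ ()) ¬p

_⇔-dec_ : {A B : Set} → Dec A → Dec B → Dec (A ⇔ B)
A? ⇔-dec B? = map′ (uncurry mk⇔) (λ A⇔B → Equivalence.to A⇔B , Equivalence.from A⇔B)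
  ((A? →-dec B?) ×-dec (B? →-dec A?))

module Classical (em : ExcludedMiddle (Level.suc 0ℓ)) where

  dec : (P : Set) → Dec P
  dec P = map′ lower lift em

  dne : {P : Set} → ¬ ¬ P → P
  dne = decidable-stable (dec _)

  ¬∀⇒∃¬ : {A : Set} {B : A → Set} → ¬ (∀ x → B x) → ∃ λ x → ¬ B x
  ¬∀⇒∃¬ ¬∀ = dne λ ¬∃ → ¬∀ λ x → dne λ ¬Bx → ¬∃ (x , ¬Bx)

-- Finite types

record Finite (A : Set) : Set where
  field
    elements : List A
    complete : ∀ x → x ∈ elements

open Finite

module _ {A : Set} (F : Finite A) where

  size : ℕ
  size = List.length (elements F)

  index : A → Fin size
  index x = Any.index (complete F x)

  index-injective : ∀ {x y} → index x ≡ index y → x ≡ y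
  index-injective {x} {y} eq = trans (Any.lookup-index (complete F x))
    (trans (cong (List.lookup (elements F)) eq) (sym (Any.lookup-index (complete F y))))

  ≟-finite : DecidableEquality A
  ≟-finite x y = map′ index-injective (cong index) (index x ≟ index y)

  ∃? : {P : A → Set} → Decidable P → Dec (∃ P)
  ∃? P? = map′ Any.satisfied (λ (x , px) → lose (complete F x) px) (Any.any? P? (elements F))

  ∀? : {P : A → Set} → Decidable P → Dec (∀ x → P x)
  ∀? P? = map′ (λ all x → All.lookup all (complete F x)) (λ all → All.tabulate λ {x} _ → all x)
    (All.all? P? (elements F))

  bounded : (b : A → ℕ) → ∃ λ J → ∀ x → b x ≤ J
  bounded b = maximum (elements F) , λ x → ≤-maximum (complete F x)
    where
    maximum : List A → ℕ
    maximum = foldr (λ x J → b x ⊔ J) 0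
    ≤-maximum : ∀ {x xs} → x ∈ xs → b x ≤ maximum xs
    ≤-maximum (here refl) = m≤m⊔n _ _
    ≤-maximum (there x∈xs) = ≤-trans (≤-maximum x∈xs) (m≤n⊔m _ _)

finite-⊤ : Finite ⊤
finite-⊤ = record { elements = tt ∷ [] ; complete = λ { tt → here refl } }

finite-Bool : Finite Bool
finite-Bool = record
  { elements = true ∷ false ∷ []
  ; complete = λ { true → here refl ; false → there (here refl) } }

finite-× : {A B : Set} → Finite A → Finite B → Finite (A × B)
finite-× FA FB = record
  { elements = cartesianProduct (elements FA) (elements FB)
  ; complete = λ (a , b) → ∈-cartesianProduct⁺ (complete FA a) (complete FB b) }

finite-Vec : {A : Set} → Finite A → ∀ n → Finite (Vec A n)
finite-Vec FA zero = record { elements = [] ∷ [] ; complete = λ { [] → here refl } }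
finite-Vec FA (suc n) = record
  { elements = map (uncurry _∷_) (elements (finite-× FA (finite-Vec FA n)))
  ; complete = λ { (x ∷ xs) → ∈-map⁺ (uncurry _∷_) (complete (finite-× FA (finite-Vec FA n)) (x , xs)) } }

-- A subset of a finite type, by its characteristic vector along the enumeration.
FinSubset : {A : Set} → Finite A → Set
FinSubset F = Vec Bool (size F)

_∈[_]_ : {A : Set} → A → (F : Finite A) → FinSubset F → Set
x ∈[ F ] U = T (Vec.lookup U (index F x))

finite-FinSubset : {A : Set} (F : Finite A) → Finite (FinSubset F)
finite-FinSubset F = finite-Vec finite-Bool (size F)

∈? : {A : Set} (F : Finite A) (U : FinSubset F) → Decidable (_∈[ F ] U)
∈? F U x = T? (Vec.lookup U (index F x))

fromDec : {A : Set} (F : Finite A) {P : A → Set} → Decidable P → FinSubset F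
fromDec F P? = Vec.tabulate (λ i → does (P? (List.lookup (elements F) i)))

∈-fromDec : {A : Set} (F : Finite A) {P : A → Set} (P? : Decidable P) (x : A) →
  x ∈[ F ] fromDec F P? ⇔ P x
∈-fromDec F {P} P? x = subst (λ y → T y ⇔ P x)
  (trans (cong (λ y → does (P? y)) (Any.lookup-index (complete F x)))
         (sym (lookup∘tabulate _ (index F x))))
  (T-does (P? x))

module _ {A B : Set} (F : Finite A) (G : Finite B) (f : A → B) (U : FinSubset F) where

  private
    hit? : Decidable (λ b → ∃ λ a → a ∈[ F ] U × f a ≡ b)
    hit? b = ∃? F (λ a → ∈? F U a ×-dec ≟-finite G (f a) b)

  image : FinSubset G
  image = fromDec G hit?

  ∈-image : (b : B) → b ∈[ G ] image ⇔ (∃ λ a → a ∈[ F ] U × f a ≡ b)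
  ∈-image = ∈-fromDec G hit?

-- Words and sequences

-- Finite words are snoc lists, so that truncation to the next shorter length is proj₁.
Word : Set → ℕ → Set
Word A zero = ⊤
Word A (suc m) = Word A m × A

finite-Word : {A : Set} → Finite A → ∀ m → Finite (Word A m)
finite-Word F zero = finite-⊤
finite-Word F (suc m) = finite-× (finite-Word F m) F

module _ {A : Set} where

  prefix : (ℕ → A) → (m : ℕ) → Word A m
  prefix w zero = tt
  prefix w (suc m) = prefix w m , w m

  prefix-agree : ∀ {w w' : ℕ → A} m → prefix w m ≡ prefix w' m → ∀ i → i < m → w i ≡ w' i
  prefix-agree (suc m) eq i i<1+m with m<1+n⇒m<n∨m≡n i<1+m
  ... | inj₁ i<m = prefix-agree m (cong proj₁ eq) i i<m
  ... | inj₂ refl = cong proj₂ eq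

  _∷ₛ_ : A → (ℕ → A) → ℕ → A
  (a ∷ₛ w) zero = a
  (a ∷ₛ w) (suc i) = w i

  _++ₛ_ : ∀ {m} → Word A m → (ℕ → A) → ℕ → A
  _++ₛ_ {zero} tt w = w
  _++ₛ_ {suc m} (u , a) w = u ++ₛ (a ∷ₛ w)

  ++ₛ-drop : ∀ {m} (u : Word A m) (w : ℕ → A) t → (u ++ₛ w) (m + t) ≡ w t
  ++ₛ-drop {zero} tt w t = refl
  ++ₛ-drop {suc m} (u , a) w t = trans (cong (u ++ₛ (a ∷ₛ w)) (sym (+-suc m t))) (++ₛ-drop u (a ∷ₛ w) (suc t))

  prefix-++ₛ : ∀ {m} (u : Word A m) (w : ℕ → A) → prefix (u ++ₛ w) m ≡ u
  prefix-++ₛ {zero} tt w = refl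
  prefix-++ₛ {suc m} (u , a) w = cong₂ _,_ (prefix-++ₛ u (a ∷ₛ w))
    (trans (cong (u ++ₛ (a ∷ₛ w)) (sym (+-identityʳ m))) (++ₛ-drop u (a ∷ₛ w) 0))

  first : ∀ {m} → Word A m → A → A
  first {zero} tt a = a
  first {suc m} (u , b) a = first u b

  first-prefix : (w : ℕ → A) (m : ℕ) → first (prefix w m) (w m) ≡ w 0
  first-prefix w zero = refl
  first-prefix w (suc m) = first-prefix w m

  ++ₛ-first : ∀ {m} (u : Word A m) (w : ℕ → A) → (u ++ₛ w) 0 ≡ first u (w 0)
  ++ₛ-first {zero} tt w = refl
  ++ₛ-first {suc m} (u , a) w = ++ₛ-first u (a ∷ₛ w)

  Chain : (R : A → A → Set) → ∀ {m} → Word A m → A → Set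
  Chain R {zero} tt a = ⊤
  Chain R {suc m} (u , b) a = Chain R u b × R b a

  chain? : {R : A → A → Set} → (∀ a b → Dec (R a b)) → ∀ {m} (u : Word A m) a → Dec (Chain R u a)
  chain? R? {zero} tt a = yes tt
  chain? R? {suc m} (u , b) a = chain? R? u b ×-dec R? b a

  prefix-chain : {R : A → A → Set} {w : ℕ → A} → (∀ i → R (w i) (w (suc i))) →
    ∀ m → Chain R (prefix w m) (w m)
  prefix-chain R-w zero = tt
  prefix-chain R-w (suc m) = prefix-chain R-w m , R-w m

  chain-++ₛ : {R : A → A → Set} {w : ℕ → A} {a : A} → ∀ {m} (u : Word A m) → Chain R u a → w 0 ≡ a →
    (∀ i → R (w i) (w (suc i))) → ∀ i → R ((u ++ₛ w) i) ((u ++ₛ w) (suc i))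
  chain-++ₛ {m = zero} tt _ _ R-w = R-w
  chain-++ₛ {R = R} {w} {a} {suc m} (u , b) (chain , Rba) refl R-w = chain-++ₛ u chain refl R-bw
    where
    R-bw : ∀ i → R ((b ∷ₛ w) i) ((b ∷ₛ w) (suc i))
    R-bw zero = Rba
    R-bw (suc i) = R-w i

  prefix-limit : (s : ∀ m → Word A m) → (∀ m → proj₁ (s (suc m)) ≡ s m) →
    ∀ m → prefix (λ i → proj₂ (s (suc i))) m ≡ s m
  prefix-limit s coherent zero = refl
  prefix-limit s coherent (suc m) = cong (_, proj₂ (s (suc m))) (trans (prefix-limit s coherent m) (sym (coherent m)))

mapWord : {A B : Set} → (A → B) → ∀ {m} → Word A m → Word B m
mapWord f {zero} tt = tt
mapWord f {suc m} (u , a) = mapWord f u , f a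

prefix-map : {A B : Set} (f : A → B) (w : ℕ → A) (m : ℕ) → mapWord f (prefix w m) ≡ prefix (f ∘ w) m
prefix-map f w zero = refl
prefix-map f w (suc m) = cong (_, f (w m)) (prefix-map f w m)

splice : {A : Set} → ℕ → (ℕ → A) → (ℕ → A) → ℕ → A
splice L p q t with t ≤? L
... | yes _ = p t
... | no _ = q (t ∸ L)

module Splice {A : Set} (L : ℕ) (p q : ℕ → A) where

  splice-≤ : ∀ {t} → t ≤ L → splice L p q t ≡ p t
  splice-≤ {t} t≤L with t ≤? L
  ... | yes _ = refl
  ... | no t≰L = ⊥-elim (t≰L t≤L)

  splice-+ : p L ≡ q 0 → ∀ t → splice L p q (L + t) ≡ q t
  splice-+ joint t with L + t ≤? L
  ... | no _ = cong q (m+n∸m≡n L t)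
  ... | yes L+t≤L with m≤n⇒m<n∨m≡n (m≤m+n L t)
  ...   | inj₁ L<L+t = ⊥-elim (<-irrefl refl (<-≤-trans L<L+t L+t≤L))
  ...   | inj₂ L≡L+t = trans (cong p (sym L≡L+t))
    (trans joint (cong q (+-cancelˡ-≡ L 0 t (trans (+-identityʳ L) L≡L+t))))

  splice-step : {R : A → A → Set} {N : ℕ} → p L ≡ q 0 →
    (∀ t → t < L → R (p t) (p (suc t))) → (∀ t → t < N → R (q t) (q (suc t))) →
    ∀ t → t < L + N → R (splice L p q t) (splice L p q (suc t))
  splice-step {R} joint R-p R-q t t<L+N = go t t<L+N (suc t ≤? L)
    where
    go : ∀ t → t < _ → Dec (suc t ≤ L) → R (splice L p q t) (splice L p q (suc t))
    go t _ (yes t<L) = subst₂ R (sym (splice-≤ (<⇒≤ t<L))) (sym (splice-≤ t<L)) (R-p t t<L)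
    go t t<L+N (no t≮L) with m≤n⇒∃[o]m+o≡n (s≤s⁻¹ (≰⇒> t≮L))
    ... | t' , refl = subst₂ R (sym (splice-+ joint t'))
      (sym (trans (cong (splice L p q) (sym (+-suc L t'))) (splice-+ joint (suc t'))))
      (R-q t' (+-cancelˡ-< L t' _ t<L+N))

InfinitelyOften : (ℕ → Set) → Set
InfinitelyOften P = ∀ i → ∃ λ j → i ≤ j × P j

InfinitelyOften-suffix : {P Q : ℕ → Set} (m : ℕ) → (∀ t → Q t → P (m + t)) →
  InfinitelyOften Q → InfinitelyOften P
InfinitelyOften-suffix m Q⇒P Q-often i with Q-often i
... | j , i≤j , Qj = m + j , ≤-trans i≤j (m≤n+m j m) , Q⇒P j Qj

Until : (ℕ → Set) → (ℕ → Set) → ℕ → Set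
Until P Q i = ∃ λ m → Q (i + m) × (∀ j → j < m → P (i + j))

module _ {P Q : ℕ → Set} where

  until-fold : ∀ {i} → Q i ⊎ (P i × Until P Q (suc i)) → Until P Q i
  until-fold {i} (inj₁ Qi) = 0 , subst Q (sym (+-identityʳ i)) Qi , λ _ ()
  until-fold {i} (inj₂ (Pi , m , Q-later , P-before)) = suc m , subst Q (sym (+-suc i m)) Q-later , P-upto
    where
    P-upto : ∀ j → j < suc m → P (i + j)
    P-upto zero _ = subst P (sym (+-identityʳ i)) Pi
    P-upto (suc j) (s≤s j<m) = subst P (sym (+-suc i j)) (P-before j j<m)

  until-unfold : ∀ {i} → Until P Q i → Q i ⊎ (P i × Until P Q (suc i))
  until-unfold {i} (zero , Q-now , _) = inj₁ (subst Q (+-identityʳ i) Q-now)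
  until-unfold {i} (suc m , Q-later , P-upto) = inj₂ (subst P (+-identityʳ i) (P-upto 0 (s≤s z≤n)) ,
    m , subst Q (+-suc i m) Q-later , λ j j<m → subst P (+-suc i j) (P-upto (suc j) (s≤s j<m)))

  until-expansion : ∀ {i} → Until P Q i ⇔ (Q i ⊎ (P i × Until P Q (suc i)))
  until-expansion = mk⇔ until-unfold until-fold

  -- The expansion law pins down until only together with the fairness condition that b is
  -- not pending forever.
  until-characterisation : (b : ℕ → Bool) → (∀ i → T (b i) ⇔ (Q i ⊎ (P i × T (b (suc i))))) →
    InfinitelyOften (λ j → T (b j) → Q j) → ∀ i → T (b i) ⇔ Until P Q i
  until-characterisation b expand fulfilled i = mk⇔ forward (λ (m , Q-later , P-upto) → backward m i Q-later P-upto)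
    where
    pending : ∀ d i → T (b i) → (T (b (i + d)) → Q (i + d)) → Until P Q i
    pending d i bi fulfil with Equivalence.to (expand i) bi
    ... | inj₁ Qi = until-fold (inj₁ Qi)
    pending zero i bi fulfil | inj₂ _ =
      until-fold (inj₁ (subst Q (+-identityʳ i) (fulfil (subst (T ∘ b) (sym (+-identityʳ i)) bi))))
    pending (suc d) i bi fulfil | inj₂ (Pi , b-next) =
      until-fold (inj₂ (Pi , pending d (suc i) b-next (subst (λ t → T (b t) → Q t) (+-suc i d) fulfil)))
    forward : T (b i) → Until P Q i
    forward bi with fulfilled i
    ... | j , i≤j , fulfil = pending (j ∸ i) i bi (subst (λ t → T (b t) → Q t) (sym (m+[n∸m]≡n i≤j)) fulfil)
    backward : ∀ m i → Q (i + m) → (∀ j → j < m → P (i + j)) → T (b i)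
    backward zero i Q-now _ = Equivalence.from (expand i) (inj₁ (subst Q (+-identityʳ i) Q-now))
    backward (suc m) i Q-later P-upto = Equivalence.from (expand i)
      (inj₂ (subst P (+-identityʳ i) (P-upto 0 (s≤s z≤n)) ,
             backward m (suc i) (subst Q (+-suc i m) Q-later)
               (λ j j<m → subst P (+-suc i j) (P-upto (suc j) (s≤s j<m)))))

-- König's lemma

module Compactness (em : ExcludedMiddle (Level.suc 0ℓ)) where
  open Classical em

  infinite-pigeonhole : {A : Set} → Finite A → (P : A → ℕ → Set) →
    (∀ {a i j} → i ≤ j → P a j → P a i) → (∀ i → ∃ λ a → P a i) → ∃ λ a → ∀ i → P a i
  infinite-pigeonhole F P antitone occupied = dne λ ¬∃ →
    let escape : ∀ a → ∃ λ i → ¬ P a i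
        escape a = ¬∀⇒∃¬ (λ Pa → ¬∃ (a , Pa))
        J , J-bound = bounded F (proj₁ ∘ escape)
        a , PaJ = occupied J
    in proj₂ (escape a) (antitone (J-bound a) PaJ)

  module König {L : ℕ → Set} (finite : ∀ m → Finite (L m)) (parent : ∀ m → L (suc m) → L m)
    (R : ∀ m → L m → Set) (R-parent : ∀ m x → R (suc m) x → R m (parent m x))
    (R-nonempty : ∀ m → ∃ (R m)) where

    Descendant : ∀ m → L m → ℕ → Set
    Descendant m x zero = R m x
    Descendant m x (suc j) = ∃ λ y → parent m y ≡ x × Descendant (suc m) y j

    descendant-step : ∀ j m x → Descendant m x (suc j) → Descendant m x j
    descendant-step zero m _ (y , refl , Ry) = R-parent m y Ry
    descendant-step (suc j) m x (y , eq , d) = y , eq , descendant-step j (suc m) y d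

    descendant-antitone : ∀ {m x i j} → i ≤ j → Descendant m x j → Descendant m x i
    descendant-antitone i≤j = go (≤⇒≤′ i≤j)
      where
      go : ∀ {m x i j} → i ≤′ j → Descendant m x j → Descendant m x i
      go ≤′-refl d = d
      go {m} {x} (≤′-step {n} i≤′j) d = go i≤′j (descendant-step n m x d)

    descendants-exist : ∀ j m → ∃ λ x → Descendant m x j
    descendants-exist zero m = R-nonempty m
    descendants-exist (suc j) m with descendants-exist j (suc m)
    ... | y , d = parent m y , y , refl , d

    Unbounded : ∀ m → L m → Set
    Unbounded m x = ∀ j → Descendant m x j

    child : ∀ {m x} → Unbounded m x → ∃ λ y → parent m y ≡ x × Unbounded (suc m) y
    child {m} {x} unbounded with infinite-pigeonhole (finite (suc m))
      (λ y j → parent m y ≡ x × Descendant (suc m) y j) (λ i≤j (eq , d) → eq , descendant-antitone i≤j d)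
      (λ j → unbounded (suc j))
    ... | y , below = y , proj₁ (below 0) , λ j → proj₂ (below j)

    thread : ∀ m → ∃ (Unbounded m)
    thread zero = infinite-pigeonhole (finite 0) (Descendant 0) descendant-antitone (λ j → descendants-exist j 0)
    thread (suc m) = proj₁ (child (proj₂ (thread m))) , proj₂ (proj₂ (child (proj₂ (thread m))))

    branch : ∃ λ (s : ∀ m → L m) → (∀ m → parent m (s (suc m)) ≡ s m) × (∀ m → R m (s m))
    branch = (λ m → proj₁ (thread m)) , (λ m → proj₁ (proj₂ (child (proj₂ (thread m))))) ,
      λ m → proj₂ (thread m) 0

  word-branch : {A : Set} → Finite A → (R : ∀ m → Word A m → Set) →
    (∀ m x → R (suc m) x → R m (proj₁ x)) → (∀ m → ∃ (R m)) → ∃ λ w → ∀ m → R m (prefix w m)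
  word-branch F R R-parent R-nonempty =
    (λ i → proj₂ (s (suc i))) , λ m → subst (R m) (sym (prefix-limit s coherent m)) (Rs m)
    where
    open König (finite-Word F) (λ _ → proj₁) R R-parent R-nonempty
    s = proj₁ branch
    coherent = proj₁ (proj₂ branch)
    Rs = proj₂ (proj₂ branch)

-- Quantifier prefixes

_◂_ : {A : Set} {j : ℕ} → A → (Fin j → A) → Fin (suc j) → A
(a ◂ Π) fzero = a
(a ◂ Π) (fsuc x) = Π x

Quantified : {A : Set} {j : ℕ} → (A → Set) → Vec Quant j → ((Fin j → A) → Set) → Set
Quantified S [] P = P (λ ())
Quantified S (∃q ∷ qs) P = ∃ λ a → S a × Quantified S qs (λ Π → P (a ◂ Π))
Quantified S (∀q ∷ qs) P = ∀ a → S a → Quantified S qs (λ Π → P (a ◂ Π))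

Extensional : {A : Set} {j : ℕ} → ((Fin j → A) → Set) → Set
Extensional P = ∀ {Π Π'} → (∀ x → Π x ≡ Π' x) → P Π → P Π'

module _ {A : Set} {j : ℕ} where

  ◂-natural : {B : Set} (f : A → B) (a : A) (Π : Fin j → A) → ∀ x → f ((a ◂ Π) x) ≡ (f a ◂ (f ∘ Π)) x
  ◂-natural f a Π fzero = refl
  ◂-natural f a Π (fsuc x) = refl

  ◂-extensional : {P : (Fin (suc j) → A) → Set} → Extensional P → ∀ a → Extensional (λ Π → P (a ◂ Π))
  ◂-extensional ext a Π≗Π' = ext λ { fzero → refl ; (fsuc x) → Π≗Π' x }

cons-extensional : ∀ {k j} {P : (Fin (suc j) → Trace k) → Set} → Extensional P →
  ∀ t → Extensional (λ Π → P (cons t Π))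
cons-extensional ext t Π≗Π' = ext λ { fzero → refl ; (fsuc x) → Π≗Π' x }

cons≗◂ : ∀ {k j} (t : Trace k) (Π : Fin j → Trace k) → ∀ x → cons t Π x ≡ (t ◂ Π) x
cons≗◂ t Π fzero = refl
cons≗◂ t Π (fsuc x) = refl

module _ {A : Set} where

  Quantified-mono : ∀ {j} {S : A → Set} (qs : Vec Quant j) {P P' : (Fin j → A) → Set} →
    (∀ Π → P Π → P' Π) → Quantified S qs P → Quantified S qs P'
  Quantified-mono [] P⇒P' q = P⇒P' _ q
  Quantified-mono (∃q ∷ qs) P⇒P' (a , Sa , q) = a , Sa , Quantified-mono qs (λ Π → P⇒P' (a ◂ Π)) q
  Quantified-mono (∀q ∷ qs) P⇒P' q a Sa = Quantified-mono qs (λ Π → P⇒P' (a ◂ Π)) (q a Sa)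

  Quantified-map : ∀ {B : Set} {j} {S : A → Set} {S' : B → Set} (h : A → B) →
    (∀ a → S a → S' (h a)) → (∀ b → S' b → ∃ λ a → S a × h a ≡ b) →
    (qs : Vec Quant j) {P : (Fin j → A) → Set} {P' : (Fin j → B) → Set} →
    Extensional P' → (∀ Π → P Π → P' (h ∘ Π)) → Quantified S qs P → Quantified S' qs P'
  Quantified-map h into onto [] ext P⇒P' q = ext (λ ()) (P⇒P' _ q)
  Quantified-map h into onto (∃q ∷ qs) ext P⇒P' (a , Sa , q) =
    h a , into a Sa , Quantified-map h into onto qs (◂-extensional ext (h a))
      (λ Π p → ext (◂-natural h a Π) (P⇒P' (a ◂ Π) p)) q
  Quantified-map h into onto (∀q ∷ qs) ext P⇒P' q b S'b with onto b S'b
  ... | a , Sa , refl = Quantified-map h into onto qs (◂-extensional ext (h a))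
      (λ Π p → ext (◂-natural h a Π) (P⇒P' (a ◂ Π) p)) (q a Sa)

  Quantified? : ∀ {j} {S : A → Set} → Finite A → Decidable S → (qs : Vec Quant j) {P : (Fin j → A) → Set} →
    (∀ Π → Dec (P Π)) → Dec (Quantified S qs P)
  Quantified? F S? [] P? = P? _
  Quantified? F S? (∃q ∷ qs) P? = ∃? F λ a → S? a ×-dec Quantified? F S? qs (λ Π → P? (a ◂ Π))
  Quantified? F S? (∀q ∷ qs) P? = ∀? F λ a → S? a →-dec Quantified? F S? qs (λ Π → P? (a ◂ Π))

module _ {k : ℕ} {T : Trace k → Set} where

  QSat→Quantified : ∀ {j} (qs : Vec Quant j) {P : (Fin j → Trace k) → Set} → Extensional P →
    QSat T qs P → Quantified T qs P
  QSat→Quantified [] ext q = q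
  QSat→Quantified (∃q ∷ qs) ext (t , Tt , q) =
    t , Tt , Quantified-mono qs (λ Π → ext (cons≗◂ t Π)) (QSat→Quantified qs (cons-extensional ext t) q)
  QSat→Quantified (∀q ∷ qs) ext q t Tt =
    Quantified-mono qs (λ Π → ext (cons≗◂ t Π)) (QSat→Quantified qs (cons-extensional ext t) (q t Tt))

  Quantified→QSat : ∀ {j} (qs : Vec Quant j) {P : (Fin j → Trace k) → Set} → Extensional P →
    Quantified T qs P → QSat T qs P
  Quantified→QSat [] ext q = q
  Quantified→QSat (∃q ∷ qs) ext (t , Tt , q) =
    t , Tt , Quantified→QSat qs (cons-extensional ext t) (Quantified-mono qs (λ Π → ext (sym ∘ cons≗◂ t Π)) q)
  Quantified→QSat (∀q ∷ qs) ext q t Tt =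
    Quantified→QSat qs (cons-extensional ext t) (Quantified-mono qs (λ Π → ext (sym ∘ cons≗◂ t Π)) (q t Tt))

module Limit (em : ExcludedMiddle (Level.suc 0ℓ)) {A : Set} (finite : Finite A) (Member : ∀ m → Word A m → Set)
  (member-parent : ∀ m x → Member (suc m) x → Member m (proj₁ x))
  (member-child : ∀ m u → Member m u → ∃ λ a → Member (suc m) (u , a)) where
  open Compactness em

  Branch : (ℕ → A) → Set
  Branch w = ∀ m → Member m (prefix w m)

  -- An existential witness at the limit is a branch through the witnesses at the finite levels.
  Quantified-limit : ∀ {j} (qs : Vec Quant j) (P : ∀ m → (Fin j → Word A m) → Set)
    (P∞ : (Fin j → ℕ → A) → Set) →
    (∀ m → Extensional (P m)) → (∀ m Π → P (suc m) Π → P m (proj₁ ∘ Π)) →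
    (∀ Π → (∀ m → P m (λ x → prefix (Π x) m)) → P∞ Π) →
    (∀ m → Quantified (Member m) qs (P m)) → Quantified Branch qs P∞
  Quantified-limit [] P P∞ ext P-parent P-limit holds = P-limit (λ ()) (λ m → ext m (λ ()) (holds m))
  Quantified-limit (q ∷ qs) P P∞ ext P-parent P-limit = step q
    where
    after : ∀ w → (∀ m → Quantified (Member m) qs (λ Π → P m (prefix w m ◂ Π))) →
      Quantified Branch qs (λ Π → P∞ (w ◂ Π))
    after w = Quantified-limit qs (λ m Π → P m (prefix w m ◂ Π)) (λ Π → P∞ (w ◂ Π))
      (λ m → ◂-extensional (ext m) (prefix w m))
      (λ m Π p → ext m (◂-natural proj₁ (prefix w (suc m)) Π) (P-parent m _ p))
      (λ Π p → P-limit (w ◂ Π) (λ m → ext m (λ x → sym (◂-natural (λ t → prefix t m) w Π x)) (p m)))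
    step : (q : Quant) → (∀ m → Quantified (Member m) (q ∷ qs) (P m)) → Quantified Branch (q ∷ qs) P∞
    step ∀q holds w w-branch = after w (λ m → holds m (prefix w m) (w-branch m))
    step ∃q holds with word-branch finite R R-parent holds
      where
      R : ∀ m → Word A m → Set
      R m u = Member m u × Quantified (Member m) qs (λ Π → P m (u ◂ Π))
      R-parent : ∀ m x → R (suc m) x → R m (proj₁ x)
      R-parent m x (x-member , x-holds) = member-parent m x x-member ,
        Quantified-map proj₁ (member-parent m)
          (λ u u-member → let a , ua-member = member-child m u u-member in (u , a) , ua-member , refl)
          qs (◂-extensional (ext m) (proj₁ x)) (λ Π p → ext m (◂-natural proj₁ x Π) (P-parent m (x ◂ Π) p))
          x-holds
    ... | w , R-w = w , (λ m → proj₁ (R-w m)) , after w (λ m → proj₂ (R-w m))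

-- The tableau of an LTL formula

module _ {k n : ℕ} where

  -- A label guesses the truth value of every temporal subformula at the current position.
  Label : Body k n → Set
  Label (atom a x) = ⊤
  Label (neg φ) = Label φ
  Label (and φ ψ) = Label φ × Label ψ
  Label (next φ) = Bool × Label φ
  Label (until φ ψ) = Bool × Label φ × Label ψ

  finite-Label : (β : Body k n) → Finite (Label β)
  finite-Label (atom a x) = finite-⊤
  finite-Label (neg φ) = finite-Label φ
  finite-Label (and φ ψ) = finite-× (finite-Label φ) (finite-Label ψ)
  finite-Label (next φ) = finite-× finite-Bool (finite-Label φ)
  finite-Label (until φ ψ) = finite-× finite-Bool (finite-× (finite-Label φ) (finite-Label ψ))

  Holds : (β : Body k n) → Label β → ExtLetter k n → Set
  Holds (atom a x) _ e = a ∈ˢ lookupL e x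
  Holds (neg φ) l e = ¬ Holds φ l e
  Holds (and φ ψ) (l₁ , l₂) e = Holds φ l₁ e × Holds ψ l₂ e
  Holds (next φ) (b , _) e = T b
  Holds (until φ ψ) (b , _) e = T b

  Holds? : (β : Body k n) → ∀ l e → Dec (Holds β l e)
  Holds? (atom a x) _ e = a ∈ˢ? lookupL e x
  Holds? (neg φ) l e = ¬? (Holds? φ l e)
  Holds? (and φ ψ) (l₁ , l₂) e = Holds? φ l₁ e ×-dec Holds? ψ l₂ e
  Holds? (next φ) (b , _) e = T? b
  Holds? (until φ ψ) (b , _) e = T? b

  Step : (β : Body k n) → Label β → ExtLetter k n → Label β → ExtLetter k n → Set
  Step (atom a x) _ _ _ _ = ⊤
  Step (neg φ) l e l' e' = Step φ l e l' e'
  Step (and φ ψ) (l₁ , l₂) e (l₁' , l₂') e' = Step φ l₁ e l₁' e' × Step ψ l₂ e l₂' e'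
  Step (next φ) (b , l) e (_ , l') e' = (T b ⇔ Holds φ l' e') × Step φ l e l' e'
  Step (until φ ψ) (b , l₁ , l₂) e (b' , l₁' , l₂') e' =
    (T b ⇔ (Holds ψ l₂ e ⊎ (Holds φ l₁ e × T b'))) × Step φ l₁ e l₁' e' × Step ψ l₂ e l₂' e'

  Step? : (β : Body k n) → ∀ l e l' e' → Dec (Step β l e l' e')
  Step? (atom a x) _ _ _ _ = yes tt
  Step? (neg φ) l e l' e' = Step? φ l e l' e'
  Step? (and φ ψ) (l₁ , l₂) e (l₁' , l₂') e' = Step? φ l₁ e l₁' e' ×-dec Step? ψ l₂ e l₂' e'
  Step? (next φ) (b , l) e (_ , l') e' = (T? b ⇔-dec Holds? φ l' e') ×-dec Step? φ l e l' e'
  Step? (until φ ψ) (b , l₁ , l₂) e (b' , l₁' , l₂') e' =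
    (T? b ⇔-dec (Holds? ψ l₂ e ⊎-dec (Holds? φ l₁ e ×-dec T? b'))) ×-dec
    Step? φ l₁ e l₁' e' ×-dec Step? ψ l₂ e l₂' e'

  -- The acceptance conditions of the tableau: each must hold infinitely often along a run.
  Eventuality : Body k n → Set
  Eventuality β = Label β → ExtLetter k n → Bool

  pullback : {L L' : Set} → (L → L') → (L' → ExtLetter k n → Bool) → L → ExtLetter k n → Bool
  pullback π F l e = F (π l) e

  fulfilled : (φ ψ : Body k n) → Eventuality (until φ ψ)
  fulfilled φ ψ (b , _ , l₂) e = not b ∨ does (Holds? ψ l₂ e)

  fulfilled⇔ : (φ ψ : Body k n) → ∀ b l₁ l₂ e →
    T (fulfilled φ ψ (b , l₁ , l₂) e) ⇔ (T b → Holds ψ l₂ e)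
  fulfilled⇔ φ ψ true l₁ l₂ e = mk⇔ (λ h _ → Equivalence.to (T-does (Holds? ψ l₂ e)) h)
    (λ h → Equivalence.from (T-does (Holds? ψ l₂ e)) (h tt))
  fulfilled⇔ φ ψ false l₁ l₂ e = mk⇔ (λ _ ()) (λ _ → tt)

  eventualities : (β : Body k n) → List (Eventuality β)
  eventualities (atom a x) = []
  eventualities (neg φ) = eventualities φ
  eventualities (and φ ψ) = map (pullback proj₁) (eventualities φ) ++ map (pullback proj₂) (eventualities ψ)
  eventualities (next φ) = map (pullback proj₂) (eventualities φ)
  eventualities (until φ ψ) = fulfilled φ ψ ∷
    map (pullback (proj₁ ∘ proj₂)) (eventualities φ) ++ map (pullback (proj₂ ∘ proj₂)) (eventualities ψ)

  Consistent : (β : Body k n) → (ℕ → Label β) → ExtWord k n → Set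
  Consistent β ls w = ∀ i → Step β (ls i) (w i) (ls (suc i)) (w (suc i))

  Fair : (β : Body k n) → (ℕ → Label β) → ExtWord k n → Set
  Fair β ls w = All (λ F → InfinitelyOften (λ i → T (F (ls i) (w i)))) (eventualities β)

  tableau-sound : (β : Body k n) (ls : ℕ → Label β) (w : ExtWord k n) → Consistent β ls w → Fair β ls w →
    ∀ i → Holds β (ls i) (w i) ⇔ (w , i ⊨ β)
  tableau-sound (atom a x) ls w _ _ i = ⇔-refl
  tableau-sound (neg φ) ls w consistent fair i = ¬-cong-⇔ (tableau-sound φ ls w consistent fair i)
  tableau-sound (and φ ψ) ls w consistent fair i =
    tableau-sound φ (proj₁ ∘ ls) w (proj₁ ∘ consistent) (All.map⁻ (All.++⁻ˡ (map _ (eventualities φ)) fair)) i ×-⇔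
    tableau-sound ψ (proj₂ ∘ ls) w (proj₂ ∘ consistent) (All.map⁻ (All.++⁻ʳ (map _ (eventualities φ)) fair)) i
  tableau-sound (next φ) ls w consistent fair i =
    ⇔-trans (proj₁ (consistent i))
      (tableau-sound φ (proj₂ ∘ ls) w (proj₂ ∘ consistent) (All.map⁻ fair) (suc i))
  tableau-sound (until φ ψ) ls w consistent (fulfilled-often ∷ fair) =
    until-characterisation {P = w ,_⊨ φ} {Q = w ,_⊨ ψ} (proj₁ ∘ ls) expand ψ-often
    where
    φ-sound = tableau-sound φ (proj₁ ∘ proj₂ ∘ ls) w (proj₁ ∘ proj₂ ∘ consistent)
      (All.map⁻ (All.++⁻ˡ (map _ (eventualities φ)) fair))
    ψ-sound = tableau-sound ψ (proj₂ ∘ proj₂ ∘ ls) w (proj₂ ∘ proj₂ ∘ consistent)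
      (All.map⁻ (All.++⁻ʳ (map _ (eventualities φ)) fair))
    expand : ∀ i → T (proj₁ (ls i)) ⇔ ((w , i ⊨ ψ) ⊎ ((w , i ⊨ φ) × T (proj₁ (ls (suc i)))))
    expand i = ⇔-trans (proj₁ (consistent i)) (ψ-sound i ⊎-⇔ (φ-sound i ×-⇔ ⇔-refl))
    ψ-often : InfinitelyOften (λ j → T (proj₁ (ls j)) → w , j ⊨ ψ)
    ψ-often i with fulfilled-often i
    ... | j , i≤j , fulfilled-j = j , i≤j ,
      Equivalence.to (ψ-sound j) ∘ Equivalence.to (fulfilled⇔ φ ψ _ (proj₁ (proj₂ (ls j))) _ (w j)) fulfilled-j

module TruthLabelling (em : ExcludedMiddle (Level.suc 0ℓ)) {k n : ℕ} where
  open Classical em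

  truthLabel : (β : Body k n) → ExtWord k n → ℕ → Label β
  truthLabel (atom a x) w i = tt
  truthLabel (neg φ) w i = truthLabel φ w i
  truthLabel (and φ ψ) w i = truthLabel φ w i , truthLabel ψ w i
  truthLabel (next φ) w i = does (dec (w , suc i ⊨ φ)) , truthLabel φ w i
  truthLabel (until φ ψ) w i = does (dec (w , i ⊨ until φ ψ)) , truthLabel φ w i , truthLabel ψ w i

  truthLabel-holds : (β : Body k n) (w : ExtWord k n) → ∀ i → Holds β (truthLabel β w i) (w i) ⇔ (w , i ⊨ β)
  truthLabel-holds (atom a x) w i = ⇔-refl
  truthLabel-holds (neg φ) w i = ¬-cong-⇔ (truthLabel-holds φ w i)
  truthLabel-holds (and φ ψ) w i = truthLabel-holds φ w i ×-⇔ truthLabel-holds ψ w i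
  truthLabel-holds (next φ) w i = T-does (dec _)
  truthLabel-holds (until φ ψ) w i = T-does (dec _)

  truthLabel-consistent : (β : Body k n) (w : ExtWord k n) → Consistent β (truthLabel β w) w
  truthLabel-consistent (atom a x) w i = tt
  truthLabel-consistent (neg φ) w i = truthLabel-consistent φ w i
  truthLabel-consistent (and φ ψ) w i = truthLabel-consistent φ w i , truthLabel-consistent ψ w i
  truthLabel-consistent (next φ) w i =
    ⇔-trans (T-does (dec _)) (⇔-sym (truthLabel-holds φ w (suc i))) , truthLabel-consistent φ w i
  truthLabel-consistent (until φ ψ) w i =
    ⇔-trans (T-does (dec _)) (⇔-trans (until-expansion {P = w ,_⊨ φ} {Q = w ,_⊨ ψ})
      (⇔-sym (truthLabel-holds ψ w i) ⊎-⇔ (⇔-sym (truthLabel-holds φ w i) ×-⇔ ⇔-sym (T-does (dec _))))) ,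
    truthLabel-consistent φ w i , truthLabel-consistent ψ w i

  truthLabel-fair : (β : Body k n) (w : ExtWord k n) → Fair β (truthLabel β w) w
  truthLabel-fair (atom a x) w = []
  truthLabel-fair (neg φ) w = truthLabel-fair φ w
  truthLabel-fair (and φ ψ) w = All.++⁺ (All.map⁺ (truthLabel-fair φ w)) (All.map⁺ (truthLabel-fair ψ w))
  truthLabel-fair (next φ) w = All.map⁺ (truthLabel-fair φ w)
  truthLabel-fair (until φ ψ) w =
    fulfilled-often ∷ All.++⁺ (All.map⁺ (truthLabel-fair φ w)) (All.map⁺ (truthLabel-fair ψ w))
    where
    fulfilled-at : ∀ j → (w , j ⊨ until φ ψ → w , j ⊨ ψ) →
      T (fulfilled φ ψ (truthLabel (until φ ψ) w j) (w j))
    fulfilled-at j ψ-if-pending = Equivalence.from (fulfilled⇔ φ ψ _ (truthLabel φ w j) _ (w j))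
      (Equivalence.from (truthLabel-holds ψ w j) ∘ ψ-if-pending ∘ Equivalence.to (T-does (dec _)))
    fulfilled-often : InfinitelyOften (λ j → T (fulfilled φ ψ (truthLabel (until φ ψ) w j) (w j)))
    fulfilled-often i with dec (w , i ⊨ until φ ψ)
    ... | yes (m , ψ-later , _) = i + m , m≤m+n i m , fulfilled-at (i + m) (λ _ → ψ-later)
    ... | no ¬until = i , ≤-refl , fulfilled-at i (⊥-elim ∘ ¬until)

-- The tableau of β as a finite graph: its fair infinite paths are the labelled models of β.
module Tableau {k n : ℕ} (β : Body k n) where

  Node : Set
  Node = Label β × ExtLetter k n

  finite-Node : Finite Node
  finite-Node = finite-× (finite-Label β) (finite-Vec (finite-Vec finite-Bool k) n)

  Edge : Node → Node → Set
  Edge x y = Step β (proj₁ x) (proj₂ x) (proj₁ y) (proj₂ y)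

  Edge? : ∀ x y → Dec (Edge x y)
  Edge? x y = Step? β _ _ _ _

  Fulfils : Eventuality β → Node → Set
  Fulfils F x = T (F (proj₁ x) (proj₂ x))

  Edges : (ℕ → Node) → Set
  Edges r = ∀ i → Edge (r i) (r (suc i))

  FairRun : (ℕ → Node) → Set
  FairRun r = All (λ F → InfinitelyOften (Fulfils F ∘ r)) (eventualities β)

  FairRun-suffix : ∀ {r q} m → (∀ t → r (m + t) ≡ q t) → FairRun q → FairRun r
  FairRun-suffix m r≗q = All.map λ {F} → InfinitelyOften-suffix m (λ t → subst (Fulfils F) (sym (r≗q t)))

  record Path (a b : Node) : Set where
    field
      length : ℕ
      node   : ℕ → Node
      starts : node 0 ≡ a
      ends   : node length ≡ b
      edges  : ∀ i → i < length → Edge (node i) (node (suc i))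

  open Path

  stay : ∀ {a} → Path a a
  stay {a} = record { length = 0 ; node = λ _ → a ; starts = refl ; ends = refl ; edges = λ _ () }

  _◅_ : ∀ {a b c} → Edge a b → Path b c → Path a c
  _◅_ {a} e P = record
    { length = suc (length P) ; node = a ∷ₛ node P ; starts = refl ; ends = ends P
    ; edges = λ { zero _ → subst (Edge a) (sym (starts P)) e ; (suc i) (s≤s i<L) → edges P i i<L } }

  _++ᵖ_ : ∀ {a b c} → Path a b → Path b c → Path a c
  P ++ᵖ Q = record
    { length = length P + length Q
    ; node   = splice (length P) (node P) (node Q)
    ; starts = trans (splice-≤ z≤n) (starts P)
    ; ends   = trans (splice-+ joint (length Q)) (ends Q)
    ; edges  = splice-step {R = Edge} joint (edges P) (edges Q) }
    where
    open Splice (length P) (node P) (node Q)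
    joint = trans (ends P) (sym (starts Q))

  take : ∀ {a b c} (P : Path a b) i → i ≤ length P → node P i ≡ c → Path a c
  take P i i≤L at-i = record
    { length = i ; node = node P ; starts = starts P ; ends = at-i
    ; edges = λ t t<i → edges P t (<-≤-trans t<i i≤L) }

  drop : ∀ {a b} (P : Path a b) j → j ≤ length P → Path (node P j) b
  drop P j j≤L = record
    { length = length P ∸ j
    ; node   = λ t → node P (j + t)
    ; starts = cong (node P) (+-identityʳ j)
    ; ends   = trans (cong (node P) (m+[n∸m]≡n j≤L)) (ends P)
    ; edges  = λ t t<L-j → subst (λ u → Edge (node P (j + t)) (node P u)) (sym (+-suc j t))
        (edges P (j + t) (subst (j + t <_) (m+[n∸m]≡n j≤L) (+-monoʳ-< j t<L-j))) }

  repetition : ∀ {a b} (P : Path a b) → size finite-Node ≤ length P →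
    ∃₂ λ i j → i < j × j ≤ length P × node P i ≡ node P j
  repetition P M≤L with pigeonhole (s≤s M≤L) (λ i → index finite-Node (node P (toℕ i)))
  ... | i , j , i<j , same = toℕ i , toℕ j , i<j , s≤s⁻¹ (toℕ<n j) , index-injective finite-Node same

  -- Cutting out the loop between two visits of the same node.
  shorten : ∀ {a b} → Path a b → ∃ λ (P : Path a b) → length P ≤ size finite-Node
  shorten P = go (length P) P ≤-refl
    where
    go : ∀ fuel {a b} (P : Path a b) → length P ≤ fuel → ∃ λ (P : Path a b) → length P ≤ size finite-Node
    go zero P L≤0 = P , ≤-trans L≤0 z≤n
    go (suc fuel) P L≤fuel with length P ≤? size finite-Node
    ... | yes short = P , short
    ... | no long with repetition P (<⇒≤ (≰⇒> long))
    ... | i , j , i<j , j≤L , same = go fuel (take P i (≤-trans (<⇒≤ i<j) j≤L) same ++ᵖ drop P j j≤L)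
      (s≤s⁻¹ (<-≤-trans shorter L≤fuel))
      where
      shorter : i + (length P ∸ j) < length P
      shorter = subst (i + (length P ∸ j) <_) (m+[n∸m]≡n j≤L) (+-monoˡ-< (length P ∸ j) i<j)

  Reach≤ : ℕ → Node → Node → Set
  Reach≤ zero a b = a ≡ b
  Reach≤ (suc m) a b = a ≡ b ⊎ ∃ λ c → Edge a c × Reach≤ m c b

  Reach≤? : ∀ m a b → Dec (Reach≤ m a b)
  Reach≤? zero a b = ≟-finite finite-Node a b
  Reach≤? (suc m) a b = ≟-finite finite-Node a b ⊎-dec ∃? finite-Node (λ c → Edge? a c ×-dec Reach≤? m c b)

  Reach≤⇒Path : ∀ m {a b} → Reach≤ m a b → Path a b
  Reach≤⇒Path zero refl = stay
  Reach≤⇒Path (suc m) (inj₁ refl) = stay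
  Reach≤⇒Path (suc m) (inj₂ (c , e , reach)) = e ◅ Reach≤⇒Path m reach

  Path⇒Reach≤ : ∀ m {a b} (P : Path a b) → length P ≤ m → Reach≤ m a b
  Path⇒Reach≤ m P L≤m = go m (length P) (node P) L≤m (starts P) (ends P) (edges P)
    where
    go : ∀ m L (p : ℕ → Node) {a b} → L ≤ m → p 0 ≡ a → p L ≡ b →
      (∀ i → i < L → Edge (p i) (p (suc i))) → Reach≤ m a b
    go zero zero p _ refl refl _ = refl
    go (suc m) zero p _ refl refl _ = inj₁ refl
    go (suc m) (suc L) p (s≤s L≤m) refl p-end E =
      inj₂ (p 1 , E 0 z<s , go m L (p ∘ suc) L≤m refl p-end (λ i i<L → E (suc i) (s≤s i<L)))

  Path? : ∀ a b → Dec (Path a b)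
  Path? a b = map′ (Reach≤⇒Path M) (λ P → Path⇒Reach≤ M (proj₁ (shorten P)) (proj₂ (shorten P)))
    (Reach≤? M a b)
    where M = size finite-Node

  Cycle : Node → Set
  Cycle y = ∃ λ c → Edge y c × Path c y

  Recurrent : Node → Set
  Recurrent y = Cycle y × All (λ F → ∃ λ z → Path y z × Path z y × Fulfils F z) (eventualities β)

  Live : Node → Set
  Live x = ∃ λ y → Path x y × Recurrent y

  Live? : ∀ x → Dec (Live x)
  Live? x = ∃? finite-Node λ y → Path? x y ×-dec
    ∃? finite-Node (λ c → Edge? y c ×-dec Path? c y) ×-dec
    All.all? (λ F → ∃? finite-Node λ z → Path? y z ×-dec Path? z y ×-dec T? _) (eventualities β)

  segment : ∀ {r} → Edges r → ∀ {i j a b} → i ≤ j → r i ≡ a → r j ≡ b → Path a b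
  segment {r} E {i} {j} i≤j refl refl = record
    { length = j ∸ i
    ; node   = λ t → r (i + t)
    ; starts = cong r (+-identityʳ i)
    ; ends   = cong r (m+[n∸m]≡n i≤j)
    ; edges  = λ t _ → subst (λ u → Edge (r (i + t)) (r u)) (sym (+-suc i t)) (E (i + t)) }

  module _ (em : ExcludedMiddle (Level.suc 0ℓ)) where
    open Compactness em

    -- Every node of a fair run is live: some node y recurs, and the run between two visits
    -- of y fulfils every eventuality.
    live-complete : ∀ {r} → Edges r → FairRun r → ∀ m → Live (r m)
    live-complete {r} E fair m with infinite-pigeonhole finite-Node (λ y i → ∃ λ j → i ≤ j × r j ≡ y)
      (λ i≤i' (j , i'≤j , at-j) → j , ≤-trans i≤i' i'≤j , at-j) (λ i → r i , i , ≤-refl , refl)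
    ... | y , y-often with y-often m
    ... | i₀ , m≤i₀ , at-i₀ with y-often (suc i₀)
    ... | i₁ , i₀<i₁ , at-i₁ =
      y , segment E m≤i₀ refl at-i₀ ,
      (r (suc i₀) , subst (λ u → Edge u (r (suc i₀))) at-i₀ (E i₀) , segment E i₀<i₁ refl at-i₁) ,
      All.map detour fair
      where
      detour : ∀ {F} → InfinitelyOften (Fulfils F ∘ r) → ∃ λ z → Path y z × Path z y × Fulfils F z
      detour F-often with F-often i₀
      ... | j , i₀≤j , F-j with y-often j
      ... | i₂ , j≤i₂ , at-i₂ = r j , segment E i₀≤j at-i₀ refl , segment E j≤i₂ refl at-i₂ , F-j

  Loop : Node → Set
  Loop y = Σ (Path y y) λ P → 0 < length P

  Visits : ∀ {a b} → Path a b → Node → Set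
  Visits P z = ∃ λ j → j < length P × node P j ≡ z

  visits-++ʳ : ∀ {a b c} (P : Path a b) (Q : Path b c) {z} → Visits Q z → Visits (P ++ᵖ Q) z
  visits-++ʳ P Q (j , j<L , at-j) = length P + j , +-monoʳ-< (length P) j<L ,
    trans (Splice.splice-+ (length P) (node P) (node Q) (trans (ends P) (sym (starts Q))) j) at-j

  -- Extend a loop through y by a detour to a fulfilling node, for each eventuality.
  cover : ∀ {y} (Fs : List (Eventuality β)) → All (λ F → ∃ λ z → Path y z × Path z y × Fulfils F z) Fs →
    Loop y → ∃ λ (L : Loop y) → All (λ F → ∃ λ z → Visits (proj₁ L) z × Fulfils F z) Fs
  cover [] [] L = L , []
  cover (F ∷ Fs) ((z , y→z , z→y , F-z) ∷ detours) L with cover Fs detours L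
  ... | (P , P≢0) , visited =
    (y→z ++ᵖ (z→y ++ᵖ P) , <-≤-trans P≢0' (m≤n+m _ (length y→z))) ,
    (z , visits-++ʳ y→z (z→y ++ᵖ P) (0 , P≢0' , starts (z→y ++ᵖ P)) , F-z) ∷
    All.map (λ (z' , visits-z' , F-z') → z' , visits-++ʳ y→z (z→y ++ᵖ P) (visits-++ʳ z→y P visits-z') , F-z')
      visited
    where
    P≢0' : 0 < length z→y + length P
    P≢0' = <-≤-trans P≢0 (m≤n+m _ (length z→y))

  module Cyclic {y : Node} (L : Loop y) where

    private
      P = proj₁ L
      instance
        length≢0 : NonZero (length P)
      length≢0 = >-nonZero (proj₂ L)

    cyclic : ℕ → Node
    cyclic t = node P (t % length P)

    cyclic-start : cyclic 0 ≡ y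
    cyclic-start = trans (cong (node P) (m<n⇒m%n≡m (proj₂ L))) (starts P)

    suc-% : ∀ t → suc t % length P ≡ suc (t % length P) % length P
    suc-% t = trans (cong (λ u → suc u % length P) (m≡m%n+[m/n]*n t (length P)))
      ([m+kn]%n≡m%n (suc (t % length P)) (t / length P) (length P))

    cyclic-edges : Edges cyclic
    cyclic-edges t = subst (Edge (node P q)) (sym (trans (cong (node P) (suc-% t)) wrap))
      (edges P q (m%n<n t (length P)))
      where
      q = t % length P
      wrap : node P (suc q % length P) ≡ node P (suc q)
      wrap with m≤n⇒m<n∨m≡n (m%n<n t (length P))
      ... | inj₁ 1+q<L = cong (node P) (m<n⇒m%n≡m 1+q<L)
      ... | inj₂ 1+q≡L = trans (cong (node P) (trans (cong (_% length P) 1+q≡L) (n%n≡0 (length P))))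
        (trans (starts P) (trans (sym (ends P)) (cong (node P) (sym 1+q≡L))))

    cyclic-visits : ∀ {z} → Visits P z → InfinitelyOften (λ t → cyclic t ≡ z)
    cyclic-visits (j , j<L , at-j) i = j + i * length P , ≤-trans (m≤m*n i (length P)) (m≤n+m _ j) ,
      trans (cong (node P) (trans ([m+kn]%n≡m%n j i (length P)) (m<n⇒m%n≡m j<L))) at-j

    cyclic-fair : All (λ F → ∃ λ z → Visits P z × Fulfils F z) (eventualities β) → FairRun cyclic
    cyclic-fair = All.map λ {F} (z , visits-z , F-z) i →
      let t , i≤t , at-t = cyclic-visits visits-z i in t , i≤t , subst (Fulfils F) (sym at-t) F-z

  -- A lasso: the path to y, then forever around a loop through y visiting every eventuality.
  live-sound : ∀ {x} → Live x → ∃ λ r → r 0 ≡ x × Edges r × FairRun r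
  live-sound (y , x→y , (c , y→c , c→y) , detours) with cover _ detours (y→c ◅ c→y , z<s)
  ... | L , visited = splice (length x→y) (node x→y) cyclic , trans (splice-≤ z≤n) (starts x→y) ,
    (λ t → splice-step {R = Edge} {N = suc t} joint (edges x→y) (λ t' _ → cyclic-edges t') t
      (≤-trans (n<1+n t) (m≤n+m (suc t) (length x→y)))) ,
    FairRun-suffix (length x→y) (splice-+ joint) (cyclic-fair visited)
    where
    open Cyclic L
    open Splice (length x→y) (node x→y) cyclic
    joint = trans (ends x→y) (sym cyclic-start)

  -- A decidable description of the prefixes of the models of β.
  LivePrefix : ∀ m → Word (ExtLetter k n) m → Set
  LivePrefix m v = ∃ λ (u : Word Node m) → ∃ λ y →
    Chain Edge u y × Holds β (proj₁ (first u y)) (proj₂ (first u y)) × mapWord proj₂ u ≡ v × Live y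

  LivePrefix? : ∀ m v → Dec (LivePrefix m v)
  LivePrefix? m v = ∃? (finite-Word finite-Node m) λ u → ∃? finite-Node λ y →
    chain? Edge? u y ×-dec Holds? β _ _ ×-dec
    ≟-finite (finite-Word (finite-Vec (finite-Vec finite-Bool k) n) m) (mapWord proj₂ u) v ×-dec Live? y

Extendable : ∀ {k n} → Body k n → ∀ m → Word (ExtLetter k n) m → Set
Extendable β m v = ∃ λ w → LTLProp β w × prefix w m ≡ v

module _ (em : ExcludedMiddle (Level.suc 0ℓ)) {k n : ℕ} (β : Body k n) where
  open Tableau β
  open TruthLabelling em

  extendable⇔livePrefix : ∀ m v → Extendable β m v ⇔ LivePrefix m v
  extendable⇔livePrefix m v = mk⇔ to from
    where
    to : Extendable β m v → LivePrefix m v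
    to (w , w⊨β , refl) = prefix r m , r m , prefix-chain (truthLabel-consistent β w) m ,
      subst (λ x → Holds β (proj₁ x) (proj₂ x)) (sym (first-prefix r m))
        (Equivalence.from (truthLabel-holds β w 0) w⊨β) ,
      prefix-map proj₂ r m , live-complete em (truthLabel-consistent β w) (truthLabel-fair β w) m
      where
      r : ℕ → Node
      r i = truthLabel β w i , w i
    from : LivePrefix m v → Extendable β m v
    from (u , y , chain , holds , refl , live) with live-sound live
    ... | q , q-start , q-edges , q-fair = proj₂ ∘ r ,
      Equivalence.to (tableau-sound β (proj₁ ∘ r) (proj₂ ∘ r) r-edges r-fair 0)
        (subst (λ x → Holds β (proj₁ x) (proj₂ x)) (sym (trans (++ₛ-first u q) (cong (first u) q-start))) holds) ,
      trans (sym (prefix-map proj₂ r m)) (cong (mapWord proj₂) (prefix-++ₛ u q))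
      where
      r = u ++ₛ q
      r-edges : Edges r
      r-edges = chain-++ₛ u chain q-start q-edges
      r-fair : FairRun r
      r-fair = FairRun-suffix m (++ₛ-drop u q) q-fair

safety-closed : (em : ExcludedMiddle (Level.suc 0ℓ)) {A : Set} {P : (ℕ → A) → Set} → Safety P →
  (w : ℕ → A) → (∀ m → ∃ λ w' → P w' × prefix w' m ≡ prefix w m) → P w
safety-closed em safe w extendable = dne λ ¬Pw →
  let m , bad = safe w ¬Pw
      w' , Pw' , same-prefix = extendable m
  in bad w' (prefix-agree m same-prefix) Pw'
  where open Classical em

-- Prefix models

⊨-cong : ∀ {k n} {w w' : ExtWord k n} → (∀ i → w i ≡ w' i) → ∀ φ i → w , i ⊨ φ → w' , i ⊨ φ
⊨-cong w≗w' (atom a x) i = subst (λ e → a ∈ˢ lookupL e x) (w≗w' i)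
⊨-cong w≗w' (neg φ) i ¬φ = ¬φ ∘ ⊨-cong (sym ∘ w≗w') φ i
⊨-cong w≗w' (and φ ψ) i (φ-i , ψ-i) = ⊨-cong w≗w' φ i φ-i , ⊨-cong w≗w' ψ i ψ-i
⊨-cong w≗w' (next φ) i = ⊨-cong w≗w' φ (suc i)
⊨-cong w≗w' (until φ ψ) i (m , ψ-later , φ-upto) =
  m , ⊨-cong w≗w' ψ (i + m) ψ-later , λ j j<m → ⊨-cong w≗w' φ (i + j) (φ-upto j j<m)

zipWord : ∀ {k n} m → (Fin n → Word (Letter k) m) → Word (ExtLetter k n) m
zipWord zero Π = tt
zipWord (suc m) Π = zipWord m (proj₁ ∘ Π) , Vec.tabulate (proj₂ ∘ Π)

zipWord-cong : ∀ {k n} m {Π Π' : Fin n → Word (Letter k) m} → (∀ x → Π x ≡ Π' x) →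
  zipWord m Π ≡ zipWord m Π'
zipWord-cong zero Π≗Π' = refl
zipWord-cong (suc m) Π≗Π' =
  cong₂ _,_ (zipWord-cong m (cong proj₁ ∘ Π≗Π')) (tabulate-cong (cong proj₂ ∘ Π≗Π'))

prefix-zipAssign : ∀ {k n} (Π : Fin n → Trace k) m → prefix (zipAssign Π) m ≡ zipWord m (λ x → prefix (Π x) m)
prefix-zipAssign Π zero = refl
prefix-zipAssign Π (suc m) = cong (_, zipAssign Π m) (prefix-zipAssign Π m)

module PrefixModels {k n : ℕ} (qs : Vec Quant n) where

  finite-Prefix : ∀ m → Finite (Word (Letter k) m)
  finite-Prefix = finite-Word (finite-Vec finite-Bool k)

  PrefixModel : (Ext : ∀ m → Word (ExtLetter k n) m → Set) → ∀ m → FinSubset (finite-Prefix m) → Set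
  PrefixModel Ext m U = (∃ λ u → u ∈[ finite-Prefix m ] U) ×
    Quantified (_∈[ finite-Prefix m ] U) qs (λ Π → Ext m (zipWord m Π))

  HasPrefixModel : (Ext : ∀ m → Word (ExtLetter k n) m → Set) → ℕ → Set
  HasPrefixModel Ext m = ∃ (PrefixModel Ext m)

  hasPrefixModel? : {Ext : ∀ m → Word (ExtLetter k n) m → Set} → (∀ m v → Dec (Ext m v)) →
    ∀ m → Dec (HasPrefixModel Ext m)
  hasPrefixModel? Ext? m = ∃? (finite-FinSubset (finite-Prefix m)) λ U →
    ∃? (finite-Prefix m) (∈? (finite-Prefix m) U) ×-dec
    Quantified? (finite-Prefix m) (∈? (finite-Prefix m) U) qs (λ Π → Ext? m (zipWord m Π))

  hasPrefixModel-cong : {Ext Ext' : ∀ m → Word (ExtLetter k n) m → Set} → (∀ m v → Ext m v ⇔ Ext' m v) →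
    ∀ m → HasPrefixModel Ext m ⇔ HasPrefixModel Ext' m
  hasPrefixModel-cong Ext⇔Ext' m = mk⇔
    (λ (U , nonempty , holds) → U , nonempty , Quantified-mono qs (λ Π → Equivalence.to (Ext⇔Ext' m _)) holds)
    (λ (U , nonempty , holds) → U , nonempty , Quantified-mono qs (λ Π → Equivalence.from (Ext⇔Ext' m _)) holds)

module _ (em : ExcludedMiddle (Level.suc 0ℓ)) {k n : ℕ} (qs : Vec Quant n) (β : Body k n) where
  open Classical em
  open PrefixModels {k} qs

  satisfaction-extensional : Extensional (λ (Π : Fin n → Trace k) → zipAssign Π , 0 ⊨ β)
  satisfaction-extensional Π≗Π' = ⊨-cong (λ i → tabulate-cong (λ x → cong (λ t → t i) (Π≗Π' x))) β 0

  extendable-extensional : ∀ m → Extensional (λ Π → Extendable β m (zipWord m Π))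
  extendable-extensional m Π≗Π' = subst (Extendable β m) (zipWord-cong m Π≗Π')

  extendable-parent : ∀ m (Π : Fin n → Word (Letter k) (suc m)) →
    Extendable β (suc m) (zipWord (suc m) Π) → Extendable β m (zipWord m (proj₁ ∘ Π))
  extendable-parent m Π (w , w⊨β , same-prefix) = w , w⊨β , cong proj₁ same-prefix

  model⇒prefixModels : Satisfiable (hyper n qs β) → ∀ m → HasPrefixModel (Extendable β) m
  model⇒prefixModels (T , (t₀ , t₀∈T) , T⊨φ) m =
    U , (prefix t₀ m , prefix∈U t₀∈T) ,
    Quantified-map (λ t → prefix t m) (λ t → prefix∈U) (λ u → Equivalence.to (∈U⇔ u)) qs
      (extendable-extensional m) (λ Π Π⊨β → zipAssign Π , Π⊨β , prefix-zipAssign Π m)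
      (QSat→Quantified qs satisfaction-extensional T⊨φ)
    where
    PrefixOfT : Word (Letter k) m → Set
    PrefixOfT u = ∃ λ t → T t × prefix t m ≡ u
    U = fromDec (finite-Prefix m) (λ u → dec (PrefixOfT u))
    ∈U⇔ : ∀ u → u ∈[ finite-Prefix m ] U ⇔ PrefixOfT u
    ∈U⇔ = ∈-fromDec (finite-Prefix m) (λ u → dec (PrefixOfT u))
    prefix∈U : ∀ {t} → T t → prefix t m ∈[ finite-Prefix m ] U
    prefix∈U {t} t∈T = Equivalence.from (∈U⇔ (prefix t m)) (t , t∈T , refl)

  prefixModel-parent : ∀ m U → PrefixModel (Extendable β) (suc m) U →
    PrefixModel (Extendable β) m (image (finite-Prefix (suc m)) (finite-Prefix m) proj₁ U)
  prefixModel-parent m U ((x , x∈U) , holds) = (proj₁ x , truncation∈ x∈U) ,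
    Quantified-map proj₁ (λ _ → truncation∈) (λ u → Equivalence.to (∈image⇔ u)) qs
      (extendable-extensional m) (extendable-parent m) holds
    where
    ∈image⇔ = ∈-image (finite-Prefix (suc m)) (finite-Prefix m) proj₁ U
    truncation∈ : ∀ {x} → x ∈[ finite-Prefix (suc m) ] U →
      proj₁ x ∈[ finite-Prefix m ] image (finite-Prefix (suc m)) (finite-Prefix m) proj₁ U
    truncation∈ {x} x∈U = Equivalence.from (∈image⇔ (proj₁ x)) (x , x∈U , refl)

  module _ (safe : Safety (LTLProp β)) (S : ∀ m → FinSubset (finite-Prefix m))
    (coherent : ∀ m → image (finite-Prefix (suc m)) (finite-Prefix m) proj₁ (S (suc m)) ≡ S m)
    (S-model : ∀ m → PrefixModel (Extendable β) m (S m)) where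

    private
      finite-Letter : Finite (Letter k)
      finite-Letter = finite-Vec finite-Bool k

      Member : ∀ m → Word (Letter k) m → Set
      Member m u = u ∈[ finite-Prefix m ] S m

      ∈S⇔ : ∀ m u → Member m u ⇔ (∃ λ x → Member (suc m) x × proj₁ x ≡ u)
      ∈S⇔ m u = subst (λ V → u ∈[ finite-Prefix m ] V ⇔ (∃ λ x → Member (suc m) x × proj₁ x ≡ u))
        (coherent m)
        (∈-image (finite-Prefix (suc m)) (finite-Prefix m) proj₁ (S (suc m)) u)

      member-parent : ∀ m x → Member (suc m) x → Member m (proj₁ x)
      member-parent m x x∈S = Equivalence.from (∈S⇔ m (proj₁ x)) (x , x∈S , refl)

      member-child : ∀ m u → Member m u → ∃ λ a → Member (suc m) (u , a)
      member-child m u u∈S with Equivalence.to (∈S⇔ m u) u∈S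
      ... | x , x∈S , refl = proj₂ x , x∈S

      limit : ∀ Π → (∀ m → Extendable β m (zipWord m (λ x → prefix (Π x) m))) → zipAssign Π , 0 ⊨ β
      limit Π extendable = safety-closed em safe (zipAssign Π) λ m →
        let w , w⊨β , same-prefix = extendable m in w , w⊨β , trans same-prefix (sym (prefix-zipAssign Π m))

    open Compactness em using (word-branch)
    open Limit em finite-Letter Member member-parent member-child

    coherentPrefixModels⇒model : Satisfiable (hyper n qs β)
    coherentPrefixModels⇒model = Branch , word-branch finite-Letter Member member-parent (proj₁ ∘ S-model) ,
      Quantified→QSat qs satisfaction-extensional
        (Quantified-limit qs (λ m Π → Extendable β m (zipWord m Π)) (λ Π → zipAssign Π , 0 ⊨ β)
          extendable-extensional extendable-parent limit (proj₂ ∘ S-model))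

  prefixModels⇒model : Safety (LTLProp β) → (∀ m → HasPrefixModel (Extendable β) m) →
    Satisfiable (hyper n qs β)
  prefixModels⇒model safe models =
    coherentPrefixModels⇒model safe (proj₁ branch) (proj₁ (proj₂ branch)) (proj₂ (proj₂ branch))
    where
    open Compactness em
    open König (finite-FinSubset ∘ finite-Prefix) (λ m → image (finite-Prefix (suc m)) (finite-Prefix m) proj₁)
      (PrefixModel (Extendable β)) prefixModel-parent models

refutedAt : ∀ {k} → Formula k → ℕ → Bool
refutedAt (hyper n qs β) s = does (¬? (PrefixModels.hasPrefixModel? qs (Tableau.LivePrefix? β) s))

module _ (em : ExcludedMiddle (Level.suc 0ℓ)) {k n : ℕ} (qs : Vec Quant n) (β : Body k n) where
  open PrefixModels {k} qs using (HasPrefixModel; hasPrefixModel?; hasPrefixModel-cong)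
  open Classical em

  refutedAt⇔ : ∀ s → refutedAt (hyper n qs β) s ≡ true ⇔ (¬ HasPrefixModel (Extendable β) s)
  refutedAt⇔ s = ⇔-trans
    (⇔-trans (⇔-sym (T-≡ {does (¬? decision)})) (T-does (¬? decision)))
    (¬-cong-⇔ (hasPrefixModel-cong (λ m v → ⇔-sym (extendable⇔livePrefix em β m v)) s))
    where
    decision = hasPrefixModel? (Tableau.LivePrefix? β) s

  unsatisfiable⇔refuted : TemporalSafety (hyper n qs β) →
    (¬ Satisfiable (hyper n qs β)) ⇔ (∃ λ s → refutedAt (hyper n qs β) s ≡ true)
  unsatisfiable⇔refuted safe = mk⇔
    (λ unsat → dne λ never-refuted → unsat (prefixModels⇒model em qs β safe λ s →
      dne λ no-model → never-refuted (s , Equivalence.from (refutedAt⇔ s) no-model)))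
    (λ (s , refuted) sat → Equivalence.to (refutedAt⇔ s) refuted (model⇒prefixModels em qs β sat s))

proposition3p9 : (k : ℕ) →
    Σ (Formula k → ℕ → Bool) λ f →
    ExcludedMiddle (Level.suc 0ℓ) →
    (φ : Formula k) → TemporalSafety φ →
    (¬ Satisfiable φ) ⇔ (∃ λ s → f φ s ≡ true)
proposition3p9 k = refutedAt , λ { em (hyper n qs β) → unsatisfiable⇔refuted em qs β }
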